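{- Let $\mathcal{T}=\{(0,0),(1,0),(1/2,\sqrt{3}/2)\}\subset\mathbb{E}^2$. For any finite coloring of $\mathbb{E}^2$ there exist uncountably many $r\in\mathbb{R}^+$ such that there exist uncountably many monochromatic equilateral triangles with side length $r$ homothetic to $\mathcal{T}$. Furthermore, for any 2-coloring of the unit square $[0,1]\times[0,1]$ there exist uncountably many $r\in(0,1]$ such that there exist uncountably many monochromatic equilateral triangles (with vertices in the unit square) of side length $r$ homothetic to $\mathcal{T}$.
   Context: $\mathbb{E}^2$ denotes the Euclidean plane, identified with $\mathbb{R}^2$, and $\mathbb{R}^+$ is the set of positive reals. A finite coloring of a set $X\subset\mathbb{E}^2$ is a map $\chi:X\to\{1,\ldots,k\}$ for some positive integer $k$; it is a 2-coloring if $k=2$. A subset of $X$ is monochromatic if $\chi$ is constant on it. A triangle is regarded as the set of its three vertices, so a triangle is monochromatic if its three vertices have the same color. A set $A\subset\mathbb{E}^2$ is homothetic to a set $B\subset\mathbb{E}^2$ if $A$ can be mapped onto $B$ by a translation and a dilation (scaling by a positive real factor), i.e. $B=v+\lambda A$ for some $v\in\mathbb{R}^2$ and some real $\lambda>0$. -}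

module Defs where

open import Algebra.Bundles using (CommutativeRing)
import Algebra.Properties.Ring as RingProperties
import Algebra.Solver.Ring.NaturalCoefficients.Default as NatSolver
open import Data.Fin.Base using (Fin)
open import Data.Nat.Base using (ℕ)
open import Data.Product.Base using (_×_; _,_; ∃-syntax; proj₁; proj₂; Σ-syntax)
open import Data.Product.Relation.Binary.Pointwise.NonDependent using (×-setoid)
open import Data.Sum.Base using (_⊎_; inj₁; inj₂)
open import Data.Unit.Base using (⊤; tt)
open import Function.Bundles using (Func; Injection)
open import Level using (0ℓ; suc; _⊔_)
open import Relation.Binary.Bundles using (Setoid)
open import Relation.Binary.Core using (Rel)
open import Relation.Binary.Definitions using (_Respects_; tri<; tri≈; tri>)
open import Relation.Binary.Structures using (IsStrictTotalOrder)
import Relation.Binary.Construct.On as On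
import Relation.Binary.Construct.StrictToNonStrict as StrictToNonStrict
open import Relation.Binary.PropositionalEquality.Core using (_≡_)
import Relation.Binary.PropositionalEquality.Properties as ≡
open import Relation.Nullary.Negation.Core using (¬_; contradiction)
open import Relation.Unary using (Pred; _⊆_)
open import Relation.Unary.Relation.Binary.Equality using (≐-setoid)

restrict : ∀ {a ℓ p} (S : Setoid a ℓ) → Pred (Setoid.Carrier S) p → Setoid (a ⊔ p) ℓ
restrict S P = On.setoid {B = Σ[ x ∈ Setoid.Carrier S ] P x} S proj₁

Uncountable : ∀ {a ℓ} → Setoid a ℓ → Set (a ⊔ ℓ)
Uncountable S = ¬ Injection S (≡.setoid ℕ)

-- A model of the real numbers: classically, any two are isomorphic.
-- Quantifying over predicates in Set loses no generality under excluded
-- middle, where subsets of the carrier can be replaced by Bool-valued ones.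
record CompleteOrderedField : Set₁ where
  infix 4 _<_ _≤_
  field
    commutativeRing : CommutativeRing 0ℓ 0ℓ

  open CommutativeRing commutativeRing public

  field
    _<_                : Rel Carrier 0ℓ
    isStrictTotalOrder : IsStrictTotalOrder _≈_ _<_
    0<1                : 0# < 1#
    +-monoˡ-<          : ∀ z {x y} → x < y → x + z < y + z
    *-positive         : ∀ {x y} → 0# < x → 0# < y → 0# < x * y
    inverse            : ∀ x → ¬ (x ≈ 0#) → ∃[ y ] x * y ≈ 1#

  open IsStrictTotalOrder isStrictTotalOrder public
    using (compare; irrefl; asym; <-respʳ-≈; <-respˡ-≈)
    renaming (trans to <-trans)

  _≤_ : Rel Carrier 0ℓ
  _≤_ = StrictToNonStrict._≤_ _≈_ _<_

  IsUpperBound : Pred Carrier 0ℓ → Pred Carrier 0ℓ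
  IsUpperBound S b = ∀ x → S x → x ≤ b

  IsSupremum : Pred Carrier 0ℓ → Pred Carrier 0ℓ
  IsSupremum S s = IsUpperBound S s × (∀ b → IsUpperBound S b → s ≤ b)

  field
    supremum : (S : Pred Carrier 0ℓ) → (∃[ x ] S x) → (∃[ b ] IsUpperBound S b) →
               ∃[ s ] IsSupremum S s

module FieldProperties (R : CompleteOrderedField) where
  open CompleteOrderedField R
  open RingProperties ring using (-‿distribˡ-*; -‿distribʳ-*; -‿involutive; +-cancelʳ)
  open NatSolver commutativeSemiring using (solve; _:+_; _:*_; _:=_)

  ≤⇒≯ : ∀ {x y} → x ≤ y → ¬ (y < x)
  ≤⇒≯ (inj₁ x<y) y<x = asym x<y y<x
  ≤⇒≯ (inj₂ x≈y) y<x = irrefl (sym x≈y) y<x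

  ≮⇒≥ : ∀ {x y} → ¬ (x < y) → y ≤ x
  ≮⇒≥ {x} {y} x≮y with compare x y
  ... | tri< x<y _ _ = contradiction x<y x≮y
  ... | tri≈ _ x≈y _ = inj₂ (sym x≈y)
  ... | tri> _ _ y<x = inj₁ y<x

  ≤-respʳ-≈ : ∀ {x y z} → y ≈ z → x ≤ y → x ≤ z
  ≤-respʳ-≈ y≈z (inj₁ x<y) = inj₁ (<-respʳ-≈ y≈z x<y)
  ≤-respʳ-≈ y≈z (inj₂ x≈y) = inj₂ (trans x≈y y≈z)

  ≤-respˡ-≈ : ∀ {x y z} → x ≈ y → x ≤ z → y ≤ z
  ≤-respˡ-≈ x≈y (inj₁ x<z) = inj₁ (<-respˡ-≈ x≈y x<z)
  ≤-respˡ-≈ x≈y (inj₂ x≈z) = inj₂ (trans (sym x≈y) x≈z)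

  ≤-<-trans : ∀ {x y z} → x ≤ y → y < z → x < z
  ≤-<-trans (inj₁ x<y) y<z = <-trans x<y y<z
  ≤-<-trans (inj₂ x≈y) y<z = <-respˡ-≈ (sym x≈y) y<z

  x<x+a : ∀ x {a} → 0# < a → x < x + a
  x<x+a x {a} 0<a = <-respˡ-≈ (+-identityˡ x) (<-respʳ-≈ (+-comm a x) (+-monoˡ-< x 0<a))

  x≤x+a : ∀ x {a} → 0# ≤ a → x ≤ x + a
  x≤x+a x (inj₁ 0<a) = inj₁ (x<x+a x 0<a)
  x≤x+a x (inj₂ 0≈a) = inj₂ (trans (sym (+-identityʳ x)) (+-congˡ 0≈a))

  difference : ∀ {x y} → x < y → ∃[ a ] (0# < a × y ≈ x + a)
  difference {x} {y} x<y = y - x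
    , <-respˡ-≈ (-‿inverseʳ x) (+-monoˡ-< (- x) x<y)
    , sym (trans (+-comm x (y - x))
          (trans (+-assoc y (- x) x)
          (trans (+-congˡ (-‿inverseˡ x)) (+-identityʳ y))))

  +-nonNeg : ∀ {x y} → 0# ≤ x → 0# ≤ y → 0# ≤ x + y
  +-nonNeg {x} {y} (inj₁ 0<x) 0≤y with x≤x+a x 0≤y
  ... | inj₁ x<x+y = inj₁ (<-trans 0<x x<x+y)
  ... | inj₂ x≈x+y = inj₁ (<-respʳ-≈ x≈x+y 0<x)
  +-nonNeg {x} {y} (inj₂ 0≈x) 0≤y =
    ≤-respʳ-≈ (trans (sym (+-identityˡ y)) (+-congʳ 0≈x)) 0≤y

  0<2 : 0# < 1# + 1#
  0<2 = <-trans 0<1 (x<x+a 1# 0<1)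

  0≤3 : 0# ≤ 1# + 1# + 1#
  0≤3 = inj₁ (<-trans 0<2 (x<x+a (1# + 1#) 0<1))

  square-nonNeg : ∀ x → 0# ≤ x * x
  square-nonNeg x with compare 0# x
  ... | tri< 0<x _ _ = inj₁ (*-positive 0<x 0<x)
  ... | tri≈ _ 0≈x _ = inj₂ (trans (sym (zeroˡ x)) (*-congʳ 0≈x))
  ... | tri> _ _ x<0 = inj₁ (<-respʳ-≈ neg-square (*-positive 0<-x 0<-x))
    where
    0<-x : 0# < - x
    0<-x = <-respˡ-≈ (-‿inverseʳ x) (<-respʳ-≈ (+-identityˡ (- x)) (+-monoˡ-< (- x) x<0))
    neg-square : - x * - x ≈ x * x
    neg-square = trans (sym (-‿distribˡ-* x (- x)))
                (trans (-‿cong (sym (-‿distribʳ-* x x))) (-‿involutive (x * x)))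

  *-monoˡ-< : ∀ {x y z} → 0# < z → x < y → x * z < y * z
  *-monoˡ-< {x} {y} {z} 0<z x<y with difference x<y
  ... | a , 0<a , y≈x+a =
    <-respʳ-≈ (sym (trans (*-congʳ y≈x+a) (distribʳ z x a)))
              (x<x+a (x * z) (*-positive 0<a 0<z))

  *-cancelʳ-< : ∀ {x y z} → 0# < z → x * z < y * z → x < y
  *-cancelʳ-< {x} {y} 0<z xz<yz with compare x y
  ... | tri< x<y _ _ = x<y
  ... | tri≈ _ x≈y _ = contradiction xz<yz (irrefl (*-congʳ x≈y))
  ... | tri> _ _ y<x = contradiction xz<yz (asym (*-monoˡ-< 0<z y<x))

  square-mono-< : ∀ {x y} → 0# ≤ x → x < y → x * x < y * y
  square-mono-< {x} {y} (inj₁ 0<x) x<y = <-trans (*-monoˡ-< 0<x x<y)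
    (<-respˡ-≈ (*-comm x y) (*-monoˡ-< (<-trans 0<x x<y) x<y))
  square-mono-< {x} {y} (inj₂ 0≈x) x<y =
    <-respˡ-≈ (trans (sym (zeroˡ x)) (*-congʳ 0≈x)) (*-positive 0<y 0<y)
    where
    0<y : 0# < y
    0<y = <-respˡ-≈ (sym 0≈x) x<y

  reciprocal : ∀ x → 0# < x → Carrier
  reciprocal x 0<x = proj₁ (inverse x (λ x≈0 → irrefl (sym x≈0) 0<x))

  *-reciprocal : ∀ x (0<x : 0# < x) → x * reciprocal x 0<x ≈ 1#
  *-reciprocal x 0<x = proj₂ (inverse x (λ x≈0 → irrefl (sym x≈0) 0<x))

  half : Carrier
  half = reciprocal (1# + 1#) 0<2

  module SquareRoot (x : Carrier) (0≤x : 0# ≤ x) where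

    SquareBelow : Pred Carrier 0ℓ
    SquareBelow y = y * y ≤ x

    private
      c : Carrier
      c = x + (1# + 1#)

      x<c : x < c
      x<c = x<x+a x 0<2

      1<c : 1# < c
      1<c = ≤-<-trans (x≤x+a 1# 0≤x) (<-respʳ-≈ 1+x+1≈c (x<x+a (1# + x) 0<1))
        where
        1+x+1≈c : 1# + x + 1# ≈ c
        1+x+1≈c = trans (+-congʳ (+-comm 1# x)) (+-assoc x 1# 1#)

      0<c : 0# < c
      0<c = <-trans 0<1 1<c

      x<c² : x < c * c
      x<c² = <-trans x<c (<-respˡ-≈ (*-identityˡ c) (*-monoˡ-< 0<c 1<c))

    nonempty : ∃[ y ] SquareBelow y
    nonempty = 0# , ≤-respˡ-≈ (sym (zeroˡ 0#)) 0≤x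

    bounded : ∃[ b ] IsUpperBound SquareBelow b
    bounded = c , λ y y²≤x → ≮⇒≥ λ c<y →
      ≤⇒≯ y²≤x (<-trans x<c² (square-mono-< (inj₁ 0<c) c<y))

    root : Carrier
    root = proj₁ (supremum SquareBelow nonempty bounded)

    root-upper : IsUpperBound SquareBelow root
    root-upper = proj₁ (proj₂ (supremum SquareBelow nonempty bounded))

    root-least : ∀ b → IsUpperBound SquareBelow b → root ≤ b
    root-least = proj₂ (proj₂ (supremum SquareBelow nonempty bounded))

    root-nonNeg : 0# ≤ root
    root-nonNeg = root-upper 0# (proj₂ nonempty)

    -- With s = root, d = s + c and y = (c s + x) / d, both
    -- y² - x = (c² - x)(s² - x) / d²  and  y - s = (x - s²) / d,
    -- so s² ≠ x makes y contradict the fact that s is a least upper bound.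
    private
      s d y : Carrier
      s = root
      d = s + c

      0<d : 0# < d
      0<d with root-nonNeg
      ... | inj₁ 0<s = <-trans 0<s (x<x+a s 0<c)
      ... | inj₂ 0≈s = <-respʳ-≈ (trans (sym (+-identityˡ c)) (+-congʳ 0≈s)) 0<c

      y = (c * s + x) * reciprocal d 0<d

      yd : y * d ≈ c * s + x
      yd = trans (*-assoc _ _ _)
          (trans (*-congˡ (trans (*-comm _ d) (*-reciprocal d 0<d))) (*-identityʳ _))

      y²d² : y * y * (d * d) ≈ (c * s + x) * (c * s + x)
      y²d² = trans (solve 2 (λ y d → y :* y :* (d :* d) := y :* d :* (y :* d)) refl y d)
                   (*-cong yd yd)

      sd : s * d ≈ c * s + s * s
      sd = solve 2 (λ s c → s :* (s :+ c) := c :* s :+ s :* s) refl s c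

      y²d²-expand : (c * s + x) * (c * s + x) + (x * (s * s) + x * (c * c))
                    ≈ x * (d * d) + (c * c * (s * s) + x * x)
      y²d²-expand = solve 3 (λ c s x →
        (c :* s :+ x) :* (c :* s :+ x) :+ (x :* (s :* s) :+ x :* (c :* c))
        := x :* ((s :+ c) :* (s :+ c)) :+ (c :* c :* (s :* s) :+ x :* x)) refl c s x

      0<d² : 0# < d * d
      0<d² = *-positive 0<d 0<d

      cs-mono : ∀ {u v} → u < v → c * s + u < c * s + v
      cs-mono u<v = <-respˡ-≈ (+-comm _ _) (<-respʳ-≈ (+-comm _ _) (+-monoˡ-< (c * s) u<v))

      0≤y : ¬ (y < 0#)
      0≤y y<0 = ≤⇒≯ 0≤cs+x (<-respʳ-≈ (zeroˡ d) (<-respˡ-≈ yd (*-monoˡ-< 0<d y<0)))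
        where
        0≤cs : 0# ≤ c * s
        0≤cs with root-nonNeg
        ... | inj₁ 0<s = inj₁ (*-positive 0<c 0<s)
        ... | inj₂ 0≈s = inj₂ (trans (sym (zeroʳ c)) (*-congˡ 0≈s))
        0≤cs+x : 0# ≤ c * s + x
        0≤cs+x = +-nonNeg 0≤cs 0≤x

      root²≮ : ¬ (s * s < x)
      root²≮ s²<x with difference s²<x | difference x<c²
      ... | a , 0<a , x≈s²+a | b , 0<b , c²≈x+b =
        ≤⇒≯ (root-upper y (inj₁ y²<x)) s<y
        where
        s<y : s < y
        s<y = *-cancelʳ-< 0<d (<-respˡ-≈ (sym sd) (<-respʳ-≈ (sym yd) (cs-mono s²<x)))
        excess : x * (s * s) + x * (c * c) ≈ a * b + (c * c * (s * s) + x * x)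
        excess = trans (+-congˡ (*-congˡ c²≈x+b))
          (trans (trans (solve 3 (λ x S b → x :* S :+ x :* (x :+ b)
                                 := x :* b :+ (x :* S :+ x :* x)) refl x (s * s) b)
                        (+-congʳ (*-congʳ x≈s²+a)))
          (trans (solve 4 (λ x S a b → (S :+ a) :* b :+ (x :* S :+ x :* x)
                          := a :* b :+ ((x :+ b) :* S :+ x :* x)) refl x (s * s) a b)
                 (+-congˡ (+-congʳ (*-congʳ (sym c²≈x+b))))))
        xd² : (c * s + x) * (c * s + x) + a * b ≈ x * (d * d)
        xd² = +-cancelʳ (c * c * (s * s) + x * x) _ _
          (trans (+-assoc _ _ _) (trans (+-congˡ (sym excess)) y²d²-expand))
        y²<x : y * y < x
        y²<x = *-cancelʳ-< 0<d²
          (<-respˡ-≈ (sym y²d²) (<-respʳ-≈ xd² (x<x+a _ (*-positive 0<a 0<b))))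

      root²≯ : ¬ (x < s * s)
      root²≯ x<s² with difference x<s² | difference x<c²
      ... | a , 0<a , s²≈x+a | b , 0<b , c²≈x+b =
        ≤⇒≯ (root-least y y-upper) y<s
        where
        y<s : y < s
        y<s = *-cancelʳ-< 0<d (<-respˡ-≈ (sym yd) (<-respʳ-≈ (sym sd) (cs-mono x<s²)))
        excess : c * c * (s * s) + x * x ≈ a * b + (x * (s * s) + x * (c * c))
        excess = trans (+-congʳ (*-cong c²≈x+b s²≈x+a))
          (trans (solve 3 (λ x a b → (x :+ b) :* (x :+ a) :+ x :* x
                          := a :* b :+ (x :* (x :+ a) :+ x :* (x :+ b))) refl x a b)
                 (+-congˡ (+-cong (*-congˡ (sym s²≈x+a)) (*-congˡ (sym c²≈x+b)))))
        xd²+ : x * (d * d) + a * b ≈ (c * s + x) * (c * s + x)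
        xd²+ = sym (+-cancelʳ (x * (s * s) + x * (c * c)) _ _
          (trans y²d²-expand (trans (+-congˡ excess) (sym (+-assoc _ _ _)))))
        x<y² : x < y * y
        x<y² = *-cancelʳ-< 0<d²
          (<-respʳ-≈ (trans xd²+ (sym y²d²)) (x<x+a _ (*-positive 0<a 0<b)))
        y-upper : IsUpperBound SquareBelow y
        y-upper z z²≤x = ≮⇒≥ λ y<z →
          ≤⇒≯ z²≤x (<-trans x<y² (square-mono-< (≮⇒≥ 0≤y) y<z))

    root² : root * root ≈ x
    root² with compare (root * root) x
    ... | tri< s²<x _ _ = contradiction s²<x root²≮
    ... | tri≈ _ s²≈x _ = s²≈x
    ... | tri> _ _ x<s² = contradiction x<s² root²≯

  sqrt : ∀ x → 0# ≤ x → Carrier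
  sqrt = SquareRoot.root

module Plane (R : CompleteOrderedField) where
  open CompleteOrderedField R
  open FieldProperties R using (half; sqrt; 0≤3; square-nonNeg; +-nonNeg; ≤-respˡ-≈; ≤-respʳ-≈)

  ℝ-setoid : Setoid 0ℓ 0ℓ
  ℝ-setoid = setoid

  𝔼²-setoid : Setoid 0ℓ 0ℓ
  𝔼²-setoid = ×-setoid setoid setoid

  open Setoid 𝔼²-setoid public
    using () renaming (Carrier to 𝔼²; _≈_ to _≈₂_; sym to ≈₂-sym; trans to ≈₂-trans)

  infixl 6 _⊕_
  infixr 7 _·_

  _⊕_ : 𝔼² → 𝔼² → 𝔼²
  (x₁ , y₁) ⊕ (x₂ , y₂) = x₁ + x₂ , y₁ + y₂

  _·_ : Carrier → 𝔼² → 𝔼²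
  t · (x , y) = t * x , t * y

  dist : 𝔼² → 𝔼² → Carrier
  dist (x₁ , y₁) (x₂ , y₂) =
    sqrt ((x₁ - x₂) * (x₁ - x₂) + (y₁ - y₂) * (y₁ - y₂))
         (+-nonNeg (square-nonNeg (x₁ - x₂)) (square-nonNeg (y₁ - y₂)))

  -- Without the condition respects, one set of points could be presented by
  -- many predicates that differ only on representatives of the same point.
  record PointSet : Set₁ where
    field
      member   : Pred 𝔼² 0ℓ
      respects : member Respects _≈₂_

  open PointSet public

  PointSet-setoid : Setoid (suc 0ℓ) 0ℓ
  PointSet-setoid = On.setoid (≐-setoid 𝔼² 0ℓ) member

  open Setoid PointSet-setoid public using () renaming (_≈_ to _≐ₚ_)

  plane : PointSet
  plane = record { member = λ _ → ⊤ ; respects = λ _ _ → tt }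

  unitSquare : PointSet
  unitSquare = record
    { member   = λ { (x , y) → InUnitInterval x × InUnitInterval y }
    ; respects = λ { (x≈x′ , y≈y′) (x∈ , y∈) → resp x≈x′ x∈ , resp y≈y′ y∈ }
    }
    where
    InUnitInterval : Pred Carrier 0ℓ
    InUnitInterval x = 0# ≤ x × x ≤ 1#
    resp : InUnitInterval Respects _≈_
    resp x≈y (0≤x , x≤1) = ≤-respʳ-≈ x≈y 0≤x , ≤-respˡ-≈ x≈y x≤1

  ⟨_,_,_⟩ : 𝔼² → 𝔼² → 𝔼² → PointSet
  ⟨ a , b , c ⟩ = record
    { member   = λ p → p ≈₂ a ⊎ p ≈₂ b ⊎ p ≈₂ c
    ; respects = λ { p≈q (inj₁ p≈a)        → inj₁ (≈₂-trans (≈₂-sym p≈q) p≈a)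
                   ; p≈q (inj₂ (inj₁ p≈b)) → inj₂ (inj₁ (≈₂-trans (≈₂-sym p≈q) p≈b))
                   ; p≈q (inj₂ (inj₂ p≈c)) → inj₂ (inj₂ (≈₂-trans (≈₂-sym p≈q) p≈c))
                   }
    }

  image : 𝔼² → Carrier → PointSet → PointSet
  image v t A = record
    { member   = λ q → ∃[ p ] (member A p × q ≈₂ v ⊕ t · p)
    ; respects = λ { q≈q′ (p , p∈A , q≈) → p , p∈A , ≈₂-trans (≈₂-sym q≈q′) q≈ }
    }

  Homothetic : PointSet → PointSet → Set
  Homothetic A B = ∃[ v ] ∃[ t ] (0# < t × B ≐ₚ image v t A)

  𝒯 : PointSet
  𝒯 = ⟨ (0# , 0#) , (1# , 0#) , (half , sqrt (1# + 1# + 1#) 0≤3 * half) ⟩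

  IsEquilateralTriangle : Carrier → PointSet → Set
  IsEquilateralTriangle r Δ = ∃[ a ] ∃[ b ] ∃[ c ]
    (Δ ≐ₚ ⟨ a , b , c ⟩ × dist a b ≈ r × dist b c ≈ r × dist c a ≈ r)

  Coloring : PointSet → ℕ → Set
  Coloring X k = Func (restrict 𝔼²-setoid (member X)) (≡.setoid (Fin k))

  Monochromatic : ∀ X {k} → Coloring X k → PointSet → Set
  Monochromatic X χ Δ =
    ∀ p q (p∈X : member X p) (q∈X : member X q) → member Δ p → member Δ q →
    Func.to χ (p , p∈X) ≡ Func.to χ (q , q∈X)

  IsMonochromaticTriangle : ∀ X {k} → Coloring X k → Carrier → PointSet → Set
  IsMonochromaticTriangle X χ r Δ =
    member Δ ⊆ member X × IsEquilateralTriangle r Δ × Homothetic Δ 𝒯 × Monochromatic X χ Δ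

  UncountablyManyTriangles : ∀ X {k} → Coloring X k → Carrier → Set₁
  UncountablyManyTriangles X χ r =
    Uncountable (restrict PointSet-setoid (IsMonochromaticTriangle X χ r))

{-# OPTIONS --safe #-}

-- By a colour-focusing argument, every k-coloring of a sufficiently large
-- triangular grid contains a monochromatic homothetic copy of 𝒯. For each small
-- scale s, placing the grid at every translate t in an interval yields such a
-- copy for each t; the grid has finitely many triangles, so one of them is
-- monochromatic for uncountably many t, and its side length is s times some
-- d ≤ N. If only countably many side lengths occurred, the interval of scales
-- would be a finite union of countable sets. Small grids fit into the unit
-- square, so plane and square are handled at once.
module Submission where

open import Defs
import Algebra.Properties.Ring as RingProperties
import Algebra.Properties.Semiring.Mult as SemiringMult
import Algebra.Solver.Ring.NaturalCoefficients.Default as NatSolver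
open import Axiom.ExcludedMiddle using (ExcludedMiddle)
open import Data.Fin.Base as Fin using (Fin; toℕ; fromℕ<)
import Data.Fin.Properties as Fin
open import Data.Nat.Base as ℕ using (ℕ; zero; suc; NonZero)
import Data.Nat.DivMod as ℕ
import Data.Nat.Properties as ℕ
open import Data.Nat.Tactic.RingSolver using (solve-∀)
open import Data.Product.Base using (_×_; _,_; ∃-syntax; proj₁; proj₂)
open import Data.Sum.Base using (_⊎_; inj₁; inj₂)
open import Data.Unit.Base using (tt)
open import Function.Bundles using (Func; Injection)
open import Level using (Level; 0ℓ; _⊔_) renaming (suc to lsuc)
open import Relation.Binary.Bundles using (StrictTotalOrder)
open import Relation.Binary.Definitions using (tri<; tri≈; tri>)
import Relation.Binary.Properties.StrictTotalOrder as StrictTotalOrderProperties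
open import Relation.Binary.PropositionalEquality as ≡ using (_≡_; _≗_)
open import Relation.Nullary using (¬_; yes; no; contradiction)
open import Relation.Nullary.Decidable using (decidable-stable)
open import Relation.Unary using (Pred; _⊆_)

-- Monochromatic corners in finite colourings of the integer grid, by colour focusing.

MonochromaticCorner : ∀ {k} → (ℕ → ℕ → Fin k) → ℕ → Set
MonochromaticCorner χ N = ∃[ i ] ∃[ j ] ∃[ d ]
  (i ℕ.+ d ℕ.< N × j ℕ.+ d ℕ.< N × 0 ℕ.< d ×
   χ (i ℕ.+ d) j ≡ χ i j × χ i (j ℕ.+ d) ≡ χ i j)

-- r pairs (i , j), (i + d, j) of pairwise different colours, each of which
-- would be completed to a corner by the common focus (i , j + d) = (i , focus).
record Spokes {k} (χ : ℕ → ℕ → Fin k) (N r : ℕ) : Set where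
  field
    i focus  : ℕ
    focus<N  : focus ℕ.< N
    i<N      : i ℕ.< N
    j d      : Fin r → ℕ
    d-pos    : ∀ m → 0 ℕ.< d m
    d-bound  : ∀ m → i ℕ.+ d m ℕ.< N
    focused  : ∀ m → j m ℕ.+ d m ≡ focus
    mono     : ∀ m → χ (i ℕ.+ d m) (j m) ≡ χ i (j m)
    distinct : ∀ m n → χ i (j m) ≡ χ i (j n) → m ≡ n

funToFin-injective : ∀ {m n} {f g : Fin m → Fin n} → Fin.funToFin f ≡ Fin.funToFin g → f ≗ g
funToFin-injective {f = f} {g} eq x = ≡.trans (≡.sym (Fin.finToFun-funToFin f x))
  (≡.trans (≡.cong (λ c → Fin.finToFun c x) eq) (Fin.finToFun-funToFin g x))

column : ∀ {k} → (ℕ → ℕ → Fin k) → ∀ N → ℕ → Fin (k ℕ.^ N)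
column χ N x = Fin.funToFin λ (y : Fin N) → χ x (toℕ y)

-- An N by N window of the colouring becomes an element of a finite set, so that the pigeonhole
-- principle applies to windows.
block : ∀ {k} → (ℕ → ℕ → Fin k) → ∀ N → ℕ → Fin ((k ℕ.^ N) ℕ.^ N)
block χ N t = Fin.funToFin λ (x : Fin N) → column χ N (t ℕ.+ toℕ x)

column-injective : ∀ {k} (χ : ℕ → ℕ → Fin k) {N x x′ y} → y ℕ.< N →
  column χ N x ≡ column χ N x′ → χ x y ≡ χ x′ y
column-injective χ {N} {x} {x′} y<N eq =
  ≡.subst (λ z → χ x z ≡ χ x′ z) (Fin.toℕ-fromℕ< y<N)
    (funToFin-injective {f = λ (y : Fin N) → χ x (toℕ y)} eq (fromℕ< y<N))

block-injective : ∀ {k} (χ : ℕ → ℕ → Fin k) {N t t′ x y} → x ℕ.< N → y ℕ.< N →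
  block χ N t ≡ block χ N t′ → χ (t ℕ.+ x) y ≡ χ (t′ ℕ.+ x) y
block-injective χ {N} {t} {t′} {x} {y} x<N y<N eq =
  ≡.subst (λ z → χ (t ℕ.+ z) y ≡ χ (t′ ℕ.+ z) y) (Fin.toℕ-fromℕ< x<N)
    (column-injective χ y<N
      (funToFin-injective {f = λ (x : Fin N) → column χ N (t ℕ.+ toℕ x)} eq (fromℕ< x<N)))

-- There are `(k ^ N) ^ N` colourings of a window, so among one more horizontal offsets two give the
-- same window. The two windows may overlap; only their agreement matters.
repeatedBlock : ∀ {k} (χ : ℕ → ℕ → Fin k) N → ∃[ s ] ∃[ e ]
  (0 ℕ.< e × s ℕ.+ e ℕ.< suc ((k ℕ.^ N) ℕ.^ N) ×
   (∀ {x y} → x ℕ.< N → y ℕ.< N → χ (s ℕ.+ e ℕ.+ x) y ≡ χ (s ℕ.+ x) y))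
repeatedBlock {k} χ N
  with t , t′ , t<t′ , eq ← Fin.pigeonhole (ℕ.n<1+n ((k ℕ.^ N) ℕ.^ N)) (λ t → block χ N (toℕ t)) =
  toℕ t , toℕ t′ ℕ.∸ toℕ t , ℕ.m<n⇒0<n∸m t<t′
  , ≡.subst (ℕ._< suc ((k ℕ.^ N) ℕ.^ N)) (≡.sym t+e≡t′) (Fin.toℕ<n t′)
  , λ x<N y<N → ≡.trans (≡.cong (λ u → χ (u ℕ.+ _) _) t+e≡t′) (block-injective χ x<N y<N (≡.sym eq))
  where
  t+e≡t′ : toℕ t ℕ.+ (toℕ t′ ℕ.∸ toℕ t) ≡ toℕ t′
  t+e≡t′ = ℕ.m+[n∸m]≡n (ℕ.<⇒≤ t<t′)

-- Induction on the number of spokes. If the focus has the colour of some spoke, it completes that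
-- spoke to a corner; otherwise its colour is new and yields one more spoke.
focusing : ∀ k r → ∃[ N ] ∀ (χ : ℕ → ℕ → Fin k) → MonochromaticCorner χ N ⊎ Spokes χ N r
focusing k zero = 1 , λ χ → inj₂ record
  { i = 0 ; focus = 0 ; focus<N = ℕ.z<s ; i<N = ℕ.z<s ; j = λ () ; d = λ ()
  ; d-pos = λ () ; d-bound = λ () ; focused = λ () ; mono = λ () ; distinct = λ () }
focusing k (suc r) with focusing k r
-- Both windows start at offsets below `M` and have side `N`; the focus rises by `e`, which is below
-- `M` too. Hence `M + N` bounds both directions.
... | N , ih = M ℕ.+ N , step
  where
  M = suc ((k ℕ.^ N) ℕ.^ N)
  step : ∀ χ → MonochromaticCorner χ (M ℕ.+ N) ⊎ Spokes χ (M ℕ.+ N) (suc r)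
  step χ with repeatedBlock χ N
  ... | s , e , 0<e , s+e<M , same = extend (ih χ′)
    where
    χ′ : ℕ → ℕ → Fin k
    χ′ x y = χ (s ℕ.+ x) y

    s≤M : s ℕ.≤ M
    s≤M = ℕ.≤-trans (ℕ.m≤m+n s e) (ℕ.<⇒≤ s+e<M)

    widen : ∀ {x} → x ℕ.< N → x ℕ.< M ℕ.+ N
    widen x<N = ℕ.≤-trans x<N (ℕ.m≤n+m N M)

    corner : MonochromaticCorner χ′ N → MonochromaticCorner χ (M ℕ.+ N)
    corner (i , j , d , i+d<N , j+d<N , 0<d , right , up) =
      s ℕ.+ i , j , d
      , ≡.subst (ℕ._< M ℕ.+ N) (≡.sym (ℕ.+-assoc s i d)) (ℕ.+-mono-≤-< s≤M i+d<N)
      , widen j+d<N , 0<d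
      , ≡.trans (≡.cong (λ x → χ x j) (ℕ.+-assoc s i d)) right , up

    extend : MonochromaticCorner χ′ N ⊎ Spokes χ′ N r →
             MonochromaticCorner χ (M ℕ.+ N) ⊎ Spokes χ (M ℕ.+ N) (suc r)
    extend (inj₁ c) = inj₁ (corner c)
    extend (inj₂ S)
      with Fin.any? (λ m → χ′ (Spokes.i S) (Spokes.focus S) Fin.≟ χ′ (Spokes.i S) (Spokes.j S m))
    ... | yes (m , eq) = inj₁ (corner
          ( i , j m , d m , d-bound m , ≡.subst (ℕ._< N) (≡.sym (focused m)) focus<N
          , d-pos m , mono m , ≡.trans (≡.cong (χ′ i) (focused m)) eq))
      where open Spokes S
    -- The new spoke joins the old focus to its copy in the second window. Each old spoke keeps its
    -- left end in the first window, while its right end moves to the second window, which has the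
    -- same colours. Every leg thus grows by `e`, and all spokes share a focus raised by `e`.
    ... | no new = inj₂ record
          { i = s ℕ.+ i ; focus = focus ℕ.+ e
          ; focus<N = ≡.subst (ℕ._< M ℕ.+ N) (ℕ.+-comm e focus)
                        (ℕ.+-mono-≤-< (ℕ.≤-trans (ℕ.m≤n+m e s) (ℕ.<⇒≤ s+e<M)) focus<N)
          ; i<N = ℕ.+-mono-≤-< s≤M i<N
          ; j = j⁺ ; d = d⁺
          ; d-pos = λ { Fin.zero → 0<e ; (Fin.suc m) → ℕ.≤-trans 0<e (ℕ.m≤m+n e (d m)) }
          ; d-bound = λ { Fin.zero → bound₀ ; (Fin.suc m) → bound₁ m }
          ; focused = λ { Fin.zero → ≡.refl
                        ; (Fin.suc m) → ≡.trans (shuffle (j m) e (d m)) (≡.cong (ℕ._+ e) (focused m)) }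
          ; mono = λ { Fin.zero → ≡.trans (≡.cong (λ x → χ x focus) (swap s i e)) (same i<N focus<N)
                     ; (Fin.suc m) → ≡.trans (≡.cong (λ x → χ x (j m)) (swap′ s i e (d m)))
                         (≡.trans (same (d-bound m) (j<N m)) (mono m)) }
          ; distinct = λ { Fin.zero Fin.zero eq → ≡.refl
                         ; Fin.zero (Fin.suc n) eq → contradiction (n , eq) new
                         ; (Fin.suc m) Fin.zero eq → contradiction (m , ≡.sym eq) new
                         ; (Fin.suc m) (Fin.suc n) eq → ≡.cong Fin.suc (distinct m n eq) }
          }
      where
      open Spokes S
      j⁺ d⁺ : Fin (suc r) → ℕ
      j⁺ Fin.zero    = focus
      j⁺ (Fin.suc m) = j m
      d⁺ Fin.zero    = e
      d⁺ (Fin.suc m) = e ℕ.+ d m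
      shuffle : ∀ a b c → a ℕ.+ (b ℕ.+ c) ≡ a ℕ.+ c ℕ.+ b
      shuffle = solve-∀
      swap : ∀ a b c → a ℕ.+ b ℕ.+ c ≡ a ℕ.+ c ℕ.+ b
      swap = solve-∀
      swap′ : ∀ a b c f → a ℕ.+ b ℕ.+ (c ℕ.+ f) ≡ a ℕ.+ c ℕ.+ (b ℕ.+ f)
      swap′ = solve-∀
      j<N : ∀ m → j m ℕ.< N
      j<N m = ℕ.≤-<-trans (ℕ.≤-trans (ℕ.m≤m+n (j m) (d m)) (ℕ.≤-reflexive (focused m))) focus<N
      bound₀ : s ℕ.+ i ℕ.+ e ℕ.< M ℕ.+ N
      bound₀ = ≡.subst (ℕ._< M ℕ.+ N) (swap s e i) (ℕ.+-mono-≤-< (ℕ.<⇒≤ s+e<M) i<N)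
      bound₁ : ∀ m → s ℕ.+ i ℕ.+ (e ℕ.+ d m) ℕ.< M ℕ.+ N
      bound₁ m = ≡.subst (ℕ._< M ℕ.+ N) (swap′ s e i (d m)) (ℕ.+-mono-≤-< (ℕ.<⇒≤ s+e<M) (d-bound m))

-- With `k` colours there cannot be `suc k` spokes of pairwise different colours, so focusing must
-- end in a corner.
gallai : ∀ k → ∃[ N ] ∀ (χ : ℕ → ℕ → Fin k) → MonochromaticCorner χ N
gallai k with focusing k (suc k)
... | N , focus = N , λ χ → conclude χ (focus χ)
  where
  conclude : ∀ χ → MonochromaticCorner χ N ⊎ Spokes χ N (suc k) → MonochromaticCorner χ N
  conclude χ (inj₁ c) = c
  conclude χ (inj₂ S) with Fin.pigeonhole (ℕ.n<1+n k) (λ m → χ (Spokes.i S) (Spokes.j S m))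
  ... | m , n , m<n , eq = contradiction (Spokes.distinct S m n eq) (Fin.<⇒≢ m<n)

-- Countable sets of reals and the uncountability of intervals.

digits-injective : ∀ {M c c′} n n′ → c ℕ.< M → c′ ℕ.< M →
  c ℕ.+ n ℕ.* M ≡ c′ ℕ.+ n′ ℕ.* M → c ≡ c′ × n ≡ n′
digits-injective {M@(suc _)} {c} {c′} n n′ c<M c′<M eq = c≡c′ , n≡n′
  where
  residue : ∀ {c} n → c ℕ.< M → (c ℕ.+ n ℕ.* M) ℕ.% M ≡ c
  residue {c} n c<M = ≡.trans (ℕ.[m+kn]%n≡m%n c n M) (ℕ.m<n⇒m%n≡m c<M)
  c≡c′ : c ≡ c′
  c≡c′ = ≡.trans (≡.sym (residue n c<M)) (≡.trans (≡.cong (ℕ._% M) eq) (residue n′ c′<M))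
  n≡n′ : n ≡ n′
  n≡n′ = ℕ.*-cancelʳ-≡ n n′ M (ℕ.+-cancelˡ-≡ c _ _
    (≡.trans eq (≡.cong (ℕ._+ n′ ℕ.* M) (≡.sym c≡c′))))

module RealAnalysis (em : ∀ ℓ → ExcludedMiddle ℓ) (R : CompleteOrderedField) where
  open CompleteOrderedField R
  open FieldProperties R

  strictTotalOrder : StrictTotalOrder 0ℓ 0ℓ 0ℓ
  strictTotalOrder = record { isStrictTotalOrder = isStrictTotalOrder }

  open StrictTotalOrderProperties strictTotalOrder
    using () renaming (trans to ≤-trans; antisym to ≤-antisym; refl to ≤-refl) public
  open StrictTotalOrder strictTotalOrder using (_<?_)

  <-≤-trans : ∀ {x y z} → x < y → y ≤ z → x < z
  <-≤-trans x<y (inj₁ y<z) = <-trans x<y y<z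
  <-≤-trans x<y (inj₂ y≈z) = <-respʳ-≈ y≈z x<y

  half+half : half + half ≈ 1#
  half+half = trans (+-cong (sym (*-identityˡ half)) (sym (*-identityˡ half)))
    (trans (sym (distribʳ half 1# 1#)) (*-reciprocal _ 0<2))

  -- Relational form of an injection into ℕ: an element may have several codes,
  -- so no choice function respecting _≈_ is needed.
  record Countable {a} (A : Pred Carrier a) (c : Level) : Set (a ⊔ lsuc c) where
    field
      code   : Carrier → ℕ → Set c
      coded  : ∀ {x} → A x → ∃[ n ] code x n
      unique : ∀ {x y n} → code x n → code y n → x ≈ y

  open Countable

  -- The codings merge into one by making the index `m` the last digit in base `M`;
  -- `digits-injective` recovers both parts.
  Countable-⋃< : ∀ {a b c} M {B : Pred Carrier b} (A : ℕ → Pred Carrier a) →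
    (∀ {x} → B x → ∃[ m ] (m ℕ.< M × A m x)) →
    (∀ {m} → m ℕ.< M → Countable (A m) c) → Countable B c
  Countable-⋃< M A cover C = record
    { code   = λ x n → ∃[ m ] ∃[ n′ ] ∃[ m<M ] (n ≡ m ℕ.+ n′ ℕ.* M × code (C {m} m<M) x n′)
    ; coded  = λ x∈B → let m , m<M , x∈A = cover x∈B
                           n , x↦n = coded (C m<M) x∈A
                       in m ℕ.+ n ℕ.* M , m , n , m<M , ≡.refl , x↦n
    ; unique = λ { (m , n , m<M , ≡.refl , x↦n) (m′ , n′ , m′<M , eq , y↦n′) →
                   same m<M m′<M (digits-injective n n′ m<M m′<M eq) x↦n y↦n′ }
    }
    where
    same : ∀ {x y m m′ n n′} (m<M : m ℕ.< M) (m′<M : m′ ℕ.< M) → m ≡ m′ × n ≡ n′ →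
           code (C m<M) x n → code (C m′<M) y n′ → x ≈ y
    -- The coding `C m<M` depends on the proof of the bound, so the two proofs are identified before
    -- `unique` applies.
    same m<M m′<M (≡.refl , ≡.refl) with ≡.refl ← ℕ.<-irrelevant m<M m′<M = unique (C m<M)

  -- Contrapositive of `Countable-⋃<`: the pigeonhole principle for uncountable sets.
  uncountable-⋃< : ∀ {a b c} M {B : Pred Carrier b} (A : ℕ → Pred Carrier a) →
    (∀ {x} → B x → ∃[ m ] (m ℕ.< M × A m x)) →
    ¬ Countable B c → ∃[ m ] (m ℕ.< M × ¬ Countable (A m) c)
  uncountable-⋃< M A cover B-uncountable = decidable-stable (em _) λ none →
    B-uncountable (Countable-⋃< M A cover λ m<M →
      decidable-stable (em _) λ A-uncountable → none (_ , m<M , A-uncountable))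

  0<half : 0# < half
  0<half = *-cancelʳ-< 0<2 (<-respˡ-≈ (sym (zeroˡ _))
    (<-respʳ-≈ (sym (trans (*-comm _ _) (*-reciprocal _ 0<2))) 0<1))

  dense : ∀ {x y} → x < y → ∃[ z ] (x < z × z < y)
  dense {x} {y} x<y with difference x<y
  ... | a , 0<a , y≈x+a = x + b , x<x+a x 0<b
      , <-respʳ-≈ (sym (trans y≈x+a (trans (+-congˡ a≈b+b) (sym (+-assoc x b b))))) (x<x+a (x + b) 0<b)
    where
    b = a * half
    0<b = *-positive 0<a 0<half
    a≈b+b : a ≈ b + b
    a≈b+b = sym (trans (sym (distribˡ a half half)) (trans (*-congˡ half+half) (*-identityʳ a)))

  record Interval : Set where
    constructor interval
    field
      {lo hi} : Carrier
      lo<hi   : lo < hi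

  open Interval

  -- Cantor's nested intervals: step `n` shrinks a closed interval so as to exclude the at most one
  -- real with code `n`. The supremum of the lower ends lies in all the intervals, so it can have no
  -- code.
  interval-uncountable : ∀ {c u v} → u < v → ¬ Countable (λ x → u < x × x < v) c
  interval-uncountable {c} {u} {v} u<v C with dense u<v
  -- Starting from `w` and `z` strictly inside keeps the limit in the open interval.
  ... | w , u<w , w<v with dense w<v
  ... | z , w<z , z<v = avoided
    where
    record Avoiding (n : ℕ) (I : Interval) : Set c where
      field
        next    : Interval
        lo-up   : lo I ≤ lo next
        hi-down : hi next ≤ hi I
        avoids  : ∀ {x} → code C x n → lo next ≤ x → ¬ (x ≤ hi next)

    open Avoiding

    avoid : ∀ n I → Avoiding n I
    avoid n I with em c {∃[ x ] code C x n}
    ... | no none = record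
          { next = I ; lo-up = ≤-refl ; hi-down = ≤-refl
          ; avoids = λ x↦n → contradiction (_ , x↦n) none }
    ... | yes (x , x↦n) with m , lo<m , m<hi ← dense (lo<hi I) | x <? m
    ...   | yes x<m = record
            { next = interval m<hi ; lo-up = inj₁ lo<m ; hi-down = ≤-refl
            ; avoids = λ y↦n m≤y _ → ≤⇒≯ m≤y (<-respˡ-≈ (unique C x↦n y↦n) x<m) }
    -- Here `x` may equal `m`, so the upper end must be some `l` strictly below `m`.
    ...   | no x≮m with l , lo<l , l<m ← dense lo<m = record
            { next = interval lo<l ; lo-up = ≤-refl ; hi-down = inj₁ (<-trans l<m m<hi)
            ; avoids = λ y↦n _ y≤l → x≮m (<-respˡ-≈ (unique C y↦n x↦n) (≤-<-trans y≤l l<m)) }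

    nested : ℕ → Interval
    nested zero    = interval w<z
    nested (suc n) = next (avoid n (nested n))

    lo-increasing : ∀ k n → lo (nested n) ≤ lo (nested (k ℕ.+ n))
    lo-increasing zero    n = ≤-refl
    lo-increasing (suc k) n = ≤-trans (lo-increasing k n) (lo-up (avoid (k ℕ.+ n) (nested (k ℕ.+ n))))

    hi-decreasing : ∀ k n → hi (nested (k ℕ.+ n)) ≤ hi (nested n)
    hi-decreasing zero    n = ≤-refl
    hi-decreasing (suc k) n = ≤-trans (hi-down (avoid (k ℕ.+ n) (nested (k ℕ.+ n)))) (hi-decreasing k n)

    lo<hi-all : ∀ m n → lo (nested m) < hi (nested n)
    lo<hi-all m n = ≤-<-trans (lo-increasing n m) (<-≤-trans (lo<hi (nested (n ℕ.+ m)))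
      (≡.subst (λ i → hi (nested i) ≤ hi (nested n)) (ℕ.+-comm m n) (hi-decreasing m n)))

    LowerEnd : Pred Carrier 0ℓ
    LowerEnd x = ∃[ n ] x ≈ lo (nested n)

    hi-upper : ∀ n → IsUpperBound LowerEnd (hi (nested n))
    hi-upper n x (m , x≈lo) = inj₁ (<-respˡ-≈ (sym x≈lo) (lo<hi-all m n))

    limit : ∃[ s ] IsSupremum LowerEnd s
    limit = supremum LowerEnd (_ , 0 , refl) (_ , hi-upper 0)

    avoided : _
    avoided with s , upper , least ← limit
      with n , s↦n ← coded C {s} ( <-≤-trans u<w (upper _ (0 , refl))
                                 , ≤-<-trans (least _ (hi-upper 0)) z<v)
      -- The interval that excludes code `n` is `nested (suc n)`, and `s` lies between its ends.
      = avoids (avoid n (nested n)) s↦n (upper _ (suc n , refl)) (least _ (hi-upper (suc n)))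

-- Coordinates of equilateral triangles and of the triangular grid.

module Triangles (em : ∀ ℓ → ExcludedMiddle ℓ) (R : CompleteOrderedField) where
  open CompleteOrderedField R
  open FieldProperties R
  open Plane R
  open RealAnalysis em R
  open RingProperties ring using (+-cancelʳ)
  open NatSolver commutativeSemiring using (solve; _:+_; _:*_; _:=_)
  open SemiringMult semiring using (×-homo-+) renaming (_×_ to _times_)

  +-mono-≤ : ∀ {x y u v} → x ≤ y → u ≤ v → x + u ≤ y + v
  +-mono-≤ {x} {y} {u} {v} x≤y u≤v = ≤-trans (monoˡ x≤y)
    (≤-respʳ-≈ (+-comm v y) (≤-respˡ-≈ (+-comm u y) (monoˡ u≤v)))
    where
    monoˡ : ∀ {x y z} → x ≤ y → x + z ≤ y + z
    monoˡ (inj₁ x<y) = inj₁ (+-monoˡ-< _ x<y)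
    monoˡ (inj₂ x≈y) = inj₂ (+-congʳ x≈y)

  *-monoˡ-≤ : ∀ {x y z} → 0# ≤ z → x ≤ y → x * z ≤ y * z
  *-monoˡ-≤ (inj₁ 0<z) (inj₁ x<y) = inj₁ (*-monoˡ-< 0<z x<y)
  *-monoˡ-≤ (inj₁ 0<z) (inj₂ x≈y) = inj₂ (*-congʳ x≈y)
  *-monoˡ-≤ (inj₂ 0≈z) x≤y = inj₂ (trans (*≈0 _) (sym (*≈0 _)))
    where
    *≈0 : ∀ w → w * _ ≈ 0#
    *≈0 w = trans (*-congˡ (sym 0≈z)) (zeroʳ w)

  *-nonNeg : ∀ {x y} → 0# ≤ x → 0# ≤ y → 0# ≤ x * y
  *-nonNeg {y = y} 0≤x 0≤y = ≤-respˡ-≈ (zeroˡ y) (*-monoˡ-≤ 0≤y 0≤x)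

  *-cancelʳ-≈ : ∀ {x y z} → 0# < z → x * z ≈ y * z → x ≈ y
  *-cancelʳ-≈ {x} {y} 0<z xz≈yz with compare x y
  ... | tri< x<y _ _ = contradiction (*-monoˡ-< 0<z x<y) (irrefl xz≈yz)
  ... | tri≈ _ x≈y _ = x≈y
  ... | tri> _ _ y<x = contradiction (*-monoˡ-< 0<z y<x) (irrefl (sym xz≈yz))

  reciprocal-pos : ∀ {x} (0<x : 0# < x) → 0# < reciprocal x 0<x
  reciprocal-pos {x} 0<x = *-cancelʳ-< 0<x (<-respˡ-≈ (sym (zeroˡ x))
    (<-respʳ-≈ (trans (sym (*-reciprocal x 0<x)) (*-comm x _)) 0<1))

  -- Squaring is strictly increasing on nonnegative reals. This reduces claims on distances to
  -- identities between squares.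
  sqrt-unique : ∀ {x r} (0≤x : 0# ≤ x) → 0# ≤ r → r * r ≈ x → sqrt x 0≤x ≈ r
  sqrt-unique {x} {r} 0≤x 0≤r r²≈x with compare (sqrt x 0≤x) r
  ... | tri≈ _ eq _ = eq
  ... | tri< lt _ _ = contradiction (square-mono-< (SquareRoot.root-nonNeg x 0≤x) lt)
                        (irrefl (trans (SquareRoot.root² x 0≤x) (sym r²≈x)))
  ... | tri> _ _ gt = contradiction (square-mono-< 0≤r gt)
                        (irrefl (trans r²≈x (sym (SquareRoot.root² x 0≤x))))

  height : Carrier
  height = sqrt (1# + 1# + 1#) 0≤3 * half

  height-nonNeg : 0# ≤ height
  height-nonNeg = *-nonNeg (SquareRoot.root-nonNeg _ 0≤3) (inj₁ 0<half)

  -- The square of `height` is three times that of `half`, and four squares of `half` make up the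
  -- square of `half + half`.
  half²+height² : half * half + height * height ≈ 1#
  half²+height² = trans (+-congˡ height²) (trans split (trans (*-cong half+half half+half) (*-identityˡ 1#)))
    where
    H = half * half
    height² : height * height ≈ H + H + H
    height² = trans (solve 2 (λ q h → q :* h :* (q :* h) := q :* q :* (h :* h)) refl _ _)
      (trans (*-congʳ (SquareRoot.root² _ 0≤3))
      (trans (distribʳ H _ _)
        (+-cong (trans (distribʳ H _ _) (+-cong (*-identityˡ H) (*-identityˡ H))) (*-identityˡ H))))
    split : H + (H + H + H) ≈ (half + half) * (half + half)
    split = solve 1 (λ h → h :* h :+ (h :* h :+ h :* h :+ h :* h) := (h :+ h) :* (h :+ h)) refl half

  x+y-y : ∀ x y → x + y - y ≈ x
  x+y-y x y = trans (+-assoc x y (- y)) (trans (+-congˡ (-‿inverseʳ y)) (+-identityʳ x))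

  forward² : ∀ {x y} u → y ≈ x + u → (y - x) * (y - x) ≈ u * u
  forward² {x} {y} u y≈x+u = *-cong y-x≈u y-x≈u
    where
    y-x≈u : y - x ≈ u
    y-x≈u = trans (+-congʳ (trans y≈x+u (+-comm x u))) (x+y-y u x)

  -- With `w = x - y` the sum `w + u` vanishes, so `w * (w + u)` and `(w + u) * u` agree; cancelling
  -- `w * u` leaves the squares.
  backward² : ∀ {x y} u → y ≈ x + u → (x - y) * (x - y) ≈ u * u
  backward² {x} {y} u y≈x+u = +-cancelʳ (w * u) _ _
    (trans (sym (distribˡ w w u)) (trans (*-congˡ w+u≈0) (trans (zeroʳ w)
      (trans (sym (zeroˡ u)) (trans (*-congʳ (sym w+u≈0))
        (solve 2 (λ w u → (w :+ u) :* u := u :* u :+ w :* u) refl w u))))))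
    where
    w = x - y
    w+u≈0 : w + u ≈ 0#
    w+u≈0 = +-cancelʳ x _ _ (trans (+-assoc w u x) (trans (+-congˡ (trans (+-comm u x) (sym y≈x+u)))
      (trans (+-assoc x (- y) y) (trans (+-congˡ (-‿inverseˡ y)) (+-comm x 0#)))))

  apex : Carrier → Carrier → Carrier → 𝔼²
  apex x y r = x + r * half , y + r * height

  triangle : Carrier → Carrier → Carrier → PointSet
  triangle x y r = ⟨ (x , y) , (x + r , y) , apex x y r ⟩

  triangle-equilateral : ∀ x y {r} → 0# < r → IsEquilateralTriangle r (triangle x y r)
  triangle-equilateral x y {r} 0<r = _ , _ , _ , ((λ z → z) , (λ z → z))
    , side (+-cong (backward² r refl) (backward² 0# (sym (+-identityʳ y))))
           (trans (+-congˡ (zeroˡ 0#)) (+-identityʳ _))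
    , side (+-cong (forward² (r * half) x+r) (backward² (r * height) refl)) slanted
    , side (+-cong (forward² (r * half) refl) (forward² (r * height) refl)) slanted
    where
    side : ∀ {p q s t} →
      (proj₁ p - proj₁ q) * (proj₁ p - proj₁ q) + (proj₂ p - proj₂ q) * (proj₂ p - proj₂ q) ≈ s + t →
      s + t ≈ r * r → dist p q ≈ r
    side eq eq′ = sqrt-unique _ (inj₁ 0<r) (sym (trans eq eq′))
    x+r : x + r ≈ x + r * half + r * half
    x+r = trans
      (+-congˡ (trans (sym (trans (*-congˡ half+half) (*-identityʳ r))) (distribˡ r half half)))
      (sym (+-assoc x _ _))
    slanted : r * half * (r * half) + r * height * (r * height) ≈ r * r
    slanted = trans (solve 3 (λ r a b → r :* a :* (r :* a) :+ r :* b :* (r :* b)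
                                        := r :* r :* (a :* a :+ b :* b)) refl r half height)
              (trans (*-congˡ half²+height²) (*-identityʳ _))

  -- `Homothetic` maps its first argument onto its second, so the triangle is scaled by the
  -- reciprocal of `r` and its first vertex is then moved to the origin.
  triangle-homothetic : ∀ x y {r} → 0# < r → Homothetic (triangle x y r) 𝒯
  triangle-homothetic x y {r} 0<r = v , t , reciprocal-pos 0<r , to , from
    where
    t = reciprocal r 0<r
    v = - (t * x) , - (t * y)
    fixed : ∀ z → - (t * z) + t * z ≈ 0#
    fixed z = -‿inverseˡ (t * z)
    moved : ∀ z w → - (t * z) + t * (z + w) ≈ t * w
    moved z w = trans (+-congˡ (distribˡ t z w))
      (trans (sym (+-assoc _ _ _)) (trans (+-congʳ (fixed z)) (+-identityˡ _)))
    tr≈1 : t * r ≈ 1#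
    tr≈1 = trans (*-comm t r) (*-reciprocal r 0<r)
    trw≈w : ∀ w → t * (r * w) ≈ w
    trw≈w w = trans (sym (*-assoc t r w)) (trans (*-congʳ tr≈1) (*-identityˡ w))
    vertex₁ : v ⊕ t · (x , y) ≈₂ (0# , 0#)
    vertex₁ = fixed x , fixed y
    vertex₂ : v ⊕ t · (x + r , y) ≈₂ (1# , 0#)
    vertex₂ = trans (moved x r) tr≈1 , fixed y
    vertex₃ : v ⊕ t · apex x y r ≈₂ (half , height)
    vertex₃ = trans (moved x _) (trw≈w half) , trans (moved y _) (trw≈w height)
    move-cong : ∀ {p q} → p ≈₂ q → v ⊕ t · p ≈₂ v ⊕ t · q
    move-cong (e , e′) = +-congˡ (*-congˡ e) , +-congˡ (*-congˡ e′)
    to : member 𝒯 ⊆ member (image v t (triangle x y r))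
    to (inj₁ p≈)        = _ , inj₁ (refl , refl) , ≈₂-trans p≈ (≈₂-sym vertex₁)
    to (inj₂ (inj₁ p≈)) = _ , inj₂ (inj₁ (refl , refl)) , ≈₂-trans p≈ (≈₂-sym vertex₂)
    to (inj₂ (inj₂ p≈)) = _ , inj₂ (inj₂ (refl , refl)) , ≈₂-trans p≈ (≈₂-sym vertex₃)
    from : member (image v t (triangle x y r)) ⊆ member 𝒯
    from (p , inj₁ p≈ , q≈)        = inj₁ (≈₂-trans q≈ (≈₂-trans (move-cong p≈) vertex₁))
    from (p , inj₂ (inj₁ p≈) , q≈) = inj₂ (inj₁ (≈₂-trans q≈ (≈₂-trans (move-cong p≈) vertex₂)))
    from (p , inj₂ (inj₂ p≈) , q≈) = inj₂ (inj₂ (≈₂-trans q≈ (≈₂-trans (move-cong p≈) vertex₃)))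

  -- The first vertex has the least abscissa of the three, and each triangle contains the first
  -- vertex of the other. Different horizontal translates are therefore different point sets.
  triangle-injective : ∀ {x x′ y y′ r} → 0# < r → triangle x y r ≐ₚ triangle x′ y′ r → x ≈ x′
  triangle-injective {x} {x′} {y} {y′} {r} 0<r (⊆ , ⊇) =
    ≤-antisym (leftmost (⊇ (inj₁ (refl , refl)))) (leftmost (⊆ (inj₁ (refl , refl))))
    where
    leftmost : ∀ {x x′ y y′} → member (triangle x′ y′ r) (x , y) → x′ ≤ x
    leftmost (inj₁ (e , _))        = inj₂ (sym e)
    leftmost (inj₂ (inj₁ (e , _))) = inj₁ (<-respʳ-≈ (sym e) (x<x+a _ 0<r))
    leftmost (inj₂ (inj₂ (e , _))) = inj₁ (<-respʳ-≈ (sym e) (x<x+a _ (*-positive 0<r 0<half)))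

  ι : ℕ → Carrier
  ι n = n times 1#

  ι-nonNeg : ∀ n → 0# ≤ ι n
  ι-nonNeg zero    = ≤-refl
  ι-nonNeg (suc n) = +-nonNeg (inj₁ 0<1) (ι-nonNeg n)

  ι-pos : ∀ n → 0# < ι (suc n)
  ι-pos n = <-≤-trans 0<1 (x≤x+a 1# (ι-nonNeg n))

  ι-mono : ∀ {m n} → m ℕ.≤ n → ι m ≤ ι n
  ι-mono {n = n} ℕ.z≤n       = ι-nonNeg n
  ι-mono (ℕ.s≤s m≤n) = +-mono-≤ ≤-refl (ι-mono m≤n)

  -- Coordinates in the lattice spanned by `(1# , 0#)` and `(half , height)`, scaled by `s`. This
  -- basis turns corners into homothetic copies of `𝒯`.
  gridX gridY : Carrier → ℕ → ℕ → Carrier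
  gridX s i j = s * (ι i + ι j * half)
  gridY s i j = s * (ι j * height)

  grid : Carrier → Carrier → ℕ → ℕ → 𝔼²
  grid t s i j = t + gridX s i j , gridY s i j

  gridTriangle : Carrier → Carrier → ℕ → ℕ → ℕ → PointSet
  gridTriangle t s i j d = triangle (t + gridX s i j) (gridY s i j) (s * ι d)

  grid-right : ∀ t s i j d → (t + gridX s i j + s * ι d , gridY s i j) ≈₂ grid t s (i ℕ.+ d) j
  grid-right t s i j d = trans
    (solve 6 (λ t s i j d h → t :+ s :* (i :+ j :* h) :+ s :* d := t :+ s :* (i :+ d :+ j :* h))
       refl t s (ι i) (ι j) (ι d) half)
    (+-congˡ (*-congˡ (+-congʳ (sym (×-homo-+ 1# i d))))) , refl

  grid-apex : ∀ t s i j d → apex (t + gridX s i j) (gridY s i j) (s * ι d) ≈₂ grid t s i (j ℕ.+ d)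
  grid-apex t s i j d = trans
    (solve 6 (λ t s i j d h → t :+ s :* (i :+ j :* h) :+ s :* d :* h := t :+ s :* (i :+ (j :+ d) :* h))
       refl t s (ι i) (ι j) (ι d) half)
    (+-congˡ (*-congˡ (+-congˡ (*-congʳ ιj+d)))) , trans
    (solve 4 (λ s j d h → s :* (j :* h) :+ s :* d :* h := s :* ((j :+ d) :* h)) refl s (ι j) (ι d) height)
    (*-congˡ (*-congʳ ιj+d))
    where
    ιj+d = sym (×-homo-+ 1# j d)

  -- Scales at which the grid fits into the unit square.

  module SmallGrid (N : ℕ) where

    -- A common bound for both coordinates of the unscaled grid and for its side lengths; the
    -- summand `1#` makes it invertible even for `N = 0`.
    width : Carrier
    width = ι N + ι N * half + ι N * height + 1#

    ιN*half-nonNeg : 0# ≤ ι N * half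
    ιN*half-nonNeg = *-nonNeg (ι-nonNeg N) (inj₁ 0<half)

    ιN*height-nonNeg : 0# ≤ ι N * height
    ιN*height-nonNeg = *-nonNeg (ι-nonNeg N) height-nonNeg

    width-pos : 0# < width
    width-pos = ≤-<-trans (+-nonNeg (+-nonNeg (ι-nonNeg N) ιN*half-nonNeg) ιN*height-nonNeg) (x<x+a _ 0<1)

    -- Scales below `ε` shrink the grid to at most `half`, which leaves the other half of the unit
    -- interval for the translation `t`.
    ε : Carrier
    ε = half * reciprocal width width-pos

    ε-pos : 0# < ε
    ε-pos = *-positive 0<half (reciprocal-pos width-pos)

    module _ {s} (0<s : 0# < s) (s<ε : s < ε) where

      scaled : ∀ {z} → z ≤ width → s * z ≤ half
      scaled {z} z≤width = ≤-trans
        (≤-respˡ-≈ (*-comm z s) (≤-respʳ-≈ (*-comm width s) (*-monoˡ-≤ (inj₁ 0<s) z≤width)))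
        (inj₁ (<-respʳ-≈ εwidth (*-monoˡ-< width-pos s<ε)))
        where
        εwidth : ε * width ≈ half
        εwidth = trans (*-assoc half _ width)
          (trans (*-congˡ (trans (*-comm _ width) (*-reciprocal width width-pos))) (*-identityʳ half))

      half≤1 : half ≤ 1#
      half≤1 = ≤-respʳ-≈ half+half (x≤x+a half (inj₁ 0<half))

      ≤-width : ∀ {z} → z ≤ ι N + ι N * half + ι N * height → z ≤ width
      ≤-width z≤ = ≤-trans z≤ (x≤x+a _ (inj₁ 0<1))

      side≤1 : ∀ {d} → d ℕ.≤ N → s * ι d ≤ 1#
      side≤1 d≤N = ≤-trans (scaled (≤-width (≤-trans (ι-mono d≤N)
        (≤-trans (x≤x+a _ ιN*half-nonNeg) (x≤x+a _ ιN*height-nonNeg))))) half≤1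

      grid∈unitSquare : ∀ {t i j} → 0# < t → t < half → i ℕ.< N → j ℕ.< N →
                        member unitSquare (grid t s i j)
      grid∈unitSquare {t} {i} {j} 0<t t<half i<N j<N =
        ( +-nonNeg (inj₁ 0<t) (*-nonNeg (inj₁ 0<s)
            (+-nonNeg (ι-nonNeg i) (*-nonNeg (ι-nonNeg j) (inj₁ 0<half))))
        , ≤-respʳ-≈ half+half (+-mono-≤ (inj₁ t<half) (scaled (≤-width
            (≤-trans (+-mono-≤ i≤N (*-monoˡ-≤ (inj₁ 0<half) j≤N)) (x≤x+a _ ιN*height-nonNeg))))))
        , *-nonNeg (inj₁ 0<s) (*-nonNeg (ι-nonNeg j) height-nonNeg)
        , ≤-trans (scaled (≤-width (≤-trans (*-monoˡ-≤ height-nonNeg j≤N)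
            (≤-respˡ-≈ (+-identityˡ _)
              (+-mono-≤ (+-nonNeg (ι-nonNeg N) ιN*half-nonNeg) ≤-refl))))) half≤1
        where
        i≤N = ι-mono (ℕ.<⇒≤ i<N)
        j≤N = ι-mono (ℕ.<⇒≤ j<N)

  -- Uncountably many triangles for each small scale, and uncountably many side lengths.

  module _ {k} (X : PointSet) (square⊆X : member unitSquare ⊆ member X) (χ : Coloring X k)
           N (corner : ∀ (f : ℕ → ℕ → Fin k) → MonochromaticCorner f N) where

    colour : ∀ p → member X p → Fin k
    colour p p∈X = Func.to χ (p , p∈X)

    -- `χ` colours only points given with a proof of membership, whereas the corner theorem wants a
    -- colouring of all pairs of naturals. Points outside `X` get the default `c`.
    colourOr : Fin k → 𝔼² → Fin k
    colourOr c p with em 0ℓ {member X p}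
    ... | yes p∈X = colour p p∈X
    ... | no  _   = c

    -- The membership proof supplied by excluded middle may differ from the given one; equality in
    -- the domain of `χ` compares points only.
    colourOr-member : ∀ c {p q} (p∈X : member X p) → member X q → p ≈₂ q → colour p p∈X ≡ colourOr c q
    colourOr-member c {q = q} p∈X q∈X p≈q with em 0ℓ {member X q}
    ... | yes q∈X′ = Func.cong χ p≈q
    ... | no  q∉X  = contradiction q∈X q∉X

    open SmallGrid N

    -- Writing the side as `suc e` steps keeps it positive and lets `e`, like `i` and `j`, range
    -- below `N`.
    IsMonoGridTriangle : Carrier → ℕ → ℕ → ℕ → Pred Carrier 0ℓ
    IsMonoGridTriangle s e i j t =
      IsMonochromaticTriangle X χ (s * ι (suc e)) (gridTriangle t s i j (suc e))

    module _ {s} (0<s : 0# < s) (s<ε : s < ε) where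

      monoGridTriangle : ∀ {t} → 0# < t × t < half →
        ∃[ e ] (e ℕ.< N × ∃[ i ] (i ℕ.< N × ∃[ j ] (j ℕ.< N × IsMonoGridTriangle s e i j t)))
      monoGridTriangle {t} (0<t , t<half) = found (corner f)
        where
        f : ℕ → ℕ → Fin k
        -- The colour of the origin, which lies in the unit square and so in `X`, serves as default;
        -- the corner found uses only grid points in `X`.
        f i j = colourOr
          (colour (0# , 0#) (square⊆X ((≤-refl , inj₁ 0<1) , (≤-refl , inj₁ 0<1)))) (grid t s i j)
        grid∈X : ∀ {i j} → i ℕ.< N → j ℕ.< N → member X (grid t s i j)
        grid∈X i<N j<N = square⊆X (grid∈unitSquare 0<s s<ε 0<t t<half i<N j<N)
        found : MonochromaticCorner f N → _
        found (i , j , suc e , i+d<N , j+d<N , _ , right , up) =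
          e , e<N , i , i<N , j , j<N , (λ {p} → in-X {p})
          , triangle-equilateral _ _ 0<r , triangle-homothetic _ _ 0<r
          , λ p q p∈X q∈X p∈Δ q∈Δ → ≡.trans (colour≡ p∈X p∈Δ) (≡.sym (colour≡ q∈X q∈Δ))
          where
          d = suc e
          i<N = ℕ.≤-<-trans (ℕ.m≤m+n i d) i+d<N
          j<N = ℕ.≤-<-trans (ℕ.m≤m+n j d) j+d<N
          e<N : e ℕ.< N
          e<N = ℕ.≤-trans (ℕ.m≤n+m d i) (ℕ.<⇒≤ i+d<N)
          0<r : 0# < s * ι d
          0<r = *-positive 0<s (ι-pos e)
          vertex : ∀ {p} → member (gridTriangle t s i j d) p →
            ∃[ i′ ] ∃[ j′ ] (i′ ℕ.< N × j′ ℕ.< N × f i′ j′ ≡ f i j × p ≈₂ grid t s i′ j′)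
          vertex (inj₁ p≈)        = i , j , i<N , j<N , ≡.refl , p≈
          vertex (inj₂ (inj₁ p≈)) = i ℕ.+ d , j , i+d<N , j<N , right , ≈₂-trans p≈ (grid-right t s i j d)
          vertex (inj₂ (inj₂ p≈)) = i , j ℕ.+ d , i<N , j+d<N , up , ≈₂-trans p≈ (grid-apex t s i j d)
          in-X : member (gridTriangle t s i j d) ⊆ member X
          in-X p∈Δ with _ , _ , i′<N , j′<N , _ , p≈ ← vertex p∈Δ =
            respects X (≈₂-sym p≈) (grid∈X i′<N j′<N)
          colour≡ : ∀ {p} (p∈X : member X p) → member (gridTriangle t s i j d) p → colour p p∈X ≡ f i j
          colour≡ p∈X p∈Δ with _ , _ , i′<N , j′<N , same , p≈ ← vertex p∈Δ =
            ≡.trans (colourOr-member _ p∈X (grid∈X i′<N j′<N) p≈) same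

      -- A numbering of the triangles would number the translations, since the leftmost vertex
      -- determines `t`.
      uncountableFamily : ∀ e i j → ¬ Countable (IsMonoGridTriangle s e i j) 0ℓ →
        UncountablyManyTriangles X χ (s * ι (suc e))
      uncountableFamily e i j uncountable φ = uncountable record
        { code   = λ t n → ∃[ mono ] Injection.to φ (gridTriangle t s i j (suc e) , mono) ≡ n
        ; coded  = λ mono → _ , mono , ≡.refl
        ; unique = λ { (_ , ≡.refl) (_ , eq) → +-cancelʳ (gridX s i j) _ _
            (triangle-injective (*-positive 0<s (ι-pos e)) (Injection.injective φ (≡.sym eq))) }
        }

      manyTriangles : ∃[ e ] (e ℕ.< N × UncountablyManyTriangles X χ (s * ι (suc e)))
      manyTriangles =
        -- The translations between `0#` and `half` are split by `e`, then by `i`, then by `j`,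
        -- keeping an uncountable class each time. The final indices no longer depend on `t`.
        let e , e<N , uncountable-e = uncountable-⋃< N
              (λ e t → ∃[ i ] (i ℕ.< N × ∃[ j ] (j ℕ.< N × IsMonoGridTriangle s e i j t)))
              monoGridTriangle (interval-uncountable {0ℓ} 0<half)
            i , _ , uncountable-i = uncountable-⋃< N
              (λ i t → ∃[ j ] (j ℕ.< N × IsMonoGridTriangle s e i j t)) (λ z → z) uncountable-e
            j , _ , uncountable-j = uncountable-⋃< N
              (λ j → IsMonoGridTriangle s e i j) (λ z → z) uncountable-i
        in e , e<N , uncountableFamily e i j uncountable-j

    -- `P` is the admissible range of sides, which differs between plane and square; all sides
    -- constructed lie in it, being positive and at most `1#`. For fixed `e` the side determines the
    -- scale, so a numbering of sides codes the scales belonging to `e`.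
    uncountablyManySides : (P : Pred Carrier 0ℓ) → (∀ {r} → 0# < r → r ≤ 1# → P r) →
      Uncountable (restrict ℝ-setoid (λ r → P r × UncountablyManyTriangles X χ r))
    uncountablyManySides P P⊇ φ = interval-uncountable ε-pos (Countable-⋃< N IsGoodScale
      (λ (0<s , s<ε) → let e , e<N , many = manyTriangles 0<s s<ε in
        e , e<N , P⊇ (*-positive 0<s (ι-pos e)) (side≤1 0<s s<ε e<N) , many)
      λ {e} _ → record
        { code   = λ s n → ∃[ good ] Injection.to φ (s * ι (suc e) , good) ≡ n
        ; coded  = λ good → _ , good , ≡.refl
        ; unique = λ { (_ , ≡.refl) (_ , eq) → *-cancelʳ-≈ (ι-pos e) (Injection.injective φ (≡.sym eq)) }
        })
      where
      IsGoodScale : ℕ → Pred Carrier (lsuc 0ℓ)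
      IsGoodScale e s = P (s * ι (suc e)) × UncountablyManyTriangles X χ (s * ι (suc e))

theorem8 : (∀ ℓ → ExcludedMiddle ℓ) →
    (R : CompleteOrderedField) →
    let open CompleteOrderedField R
        open Plane R
    in
    ((k : ℕ) .{{_ : NonZero k}} (χ : Coloring plane k) →
      Uncountable (restrict ℝ-setoid (λ r → 0# < r × UncountablyManyTriangles plane χ r)))
    ×
    ((χ : Coloring unitSquare 2) →
      Uncountable (restrict ℝ-setoid (λ r → (0# < r × r ≤ 1#) × UncountablyManyTriangles unitSquare χ r)))
theorem8 em R =
    (λ k χ → let N , corner = gallai k in
       uncountablyManySides plane (λ _ → tt) χ N corner (λ r → 0# < r) (λ 0<r _ → 0<r))
  , (λ χ → let N , corner = gallai 2 in
       uncountablyManySides unitSquare (λ p∈ → p∈) χ N corner (λ r → 0# < r × r ≤ 1#) _,_)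
  where
  open CompleteOrderedField R
  open Plane R
  open Triangles em R
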